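{- Let $(X,E)$ be an undirected simple graph with finite vertex set $X$ which is transitive, let $Y$ be a finite set and let $F:X\to 2^Y$ be a set-valued mapping. The following statements are equivalent: (i) $F$ admits a Hall collection. (ii) $F$ admits a disparate selection.
   Context: $\sharp$ denotes cardinality; $\subset$ allows equality. Empty images $F(x)$ are allowed. $(X,E)$ is called transitive if $\{x,x'\}\in E$, $\{x',x''\}\in E$ and $x\ne x''$ imply $\{x,x''\}\in E$. $G(F)=\{(x,y)\in X\times Y\mid y\in F(x)\}$, and $F_{|V}$ is the restriction of $F$ to $V\subset X$. A selection of $F$ is a map $s:X\to Y$ with $s(x)\in F(x)$ for all $x\in X$. Points $(x,y),(x',y')\in X\times Y$ are disparate if $(x,y)\ne(x',y')$ and ($y=y'$ implies $\{x,x'\}\notin E$). A set $A\subset X\times Y$ is disparate if any two distinct points of $A$ are disparate. A selection $s$ is disparate if $\{(x,s(x))\mid x\in X\}$ is a disparate set. A Hall collection of $F$ is a family $(A_V)$ indexed by the nonempty sets $V\subset X$ such that $A_V\subset G(F_{|V})$, $A_V$ is a disparate set and $\sharp A_V\ge\sharp V$ for each nonempty $V\subset X$. -}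

module Defs where

open import Data.Fin using (Fin; combine)
open import Data.Fin.Subset using (Subset; Nonempty; _∈_; ∣_∣)
open import Data.Nat using (ℕ; _*_; _≥_)
open import Data.Product using (_×_; _,_; proj₁; proj₂; ∃-syntax)
open import Level using (0ℓ)
open import Relation.Binary using (Rel; Symmetric; Decidable)
open import Relation.Binary.PropositionalEquality using (_≡_; _≢_)
open import Relation.Nullary using (¬_)
open import Relation.Unary using (Pred; _⊆_)

-- The edge set E is given by its adjacency relation: Adj x x′ means {x , x′} ∈ E.
-- Decidability is automatic classically for a finite graph.
record SimpleGraph (n : ℕ) : Set₁ where
  field
    Adj     : Rel (Fin n) 0ℓ
    adj?    : Decidable Adj
    symm    : Symmetric Adj
    irrefl  : ∀ {x} → ¬ Adj x x

open SimpleGraph public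

-- Relation.Binary.Transitive would be wrong here: with symmetry and
-- irreflexivity it would exclude every edge.  Hence the proviso x ≢ x″.
IsTransitive : ∀ {n} → SimpleGraph n → Set
IsTransitive G = ∀ {x x′ x″} → Adj G x x′ → Adj G x′ x″ → x ≢ x″ → Adj G x x″

SetValued : ℕ → ℕ → Set
SetValued n m = Fin n → Subset m

module _ {n m : ℕ} where

  Point : Set
  Point = Fin n × Fin m

  -- A finite subset of Fin n × Fin m, coded along the bijection
  -- combine : Fin n × Fin m → Fin (n * m), so that ∣_∣ is its cardinality.
  ⟦_⟧ : Subset (n * m) → Pred Point 0ℓ
  ⟦ A ⟧ (x , y) = combine x y ∈ A

  -- The graph G(F|V) of the restriction of F to V.
  GraphOn : SetValued n m → Subset n → Pred Point 0ℓ
  GraphOn F V (x , y) = x ∈ V × y ∈ F x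

  Disparate : SimpleGraph n → Rel Point 0ℓ
  Disparate G p q = p ≢ q × (proj₂ p ≡ proj₂ q → ¬ Adj G (proj₁ p) (proj₁ q))

  IsDisparateSet : SimpleGraph n → Pred Point 0ℓ → Set
  IsDisparateSet G A = ∀ {p q} → A p → A q → p ≢ q → Disparate G p q

  IsSelection : SetValued n m → (Fin n → Fin m) → Set
  IsSelection F s = ∀ x → s x ∈ F x

  IsDisparateMap : SimpleGraph n → (Fin n → Fin m) → Set
  IsDisparateMap G s = IsDisparateSet G (λ p → ∃[ x ] p ≡ (x , s x))

  -- The nonemptiness argument of the family is irrelevant, so the set
  -- depends on V alone and not on a chosen element of V.
  record HallCollection (G : SimpleGraph n) (F : SetValued n m) : Set where
    field
      A         : (V : Subset n) → .(Nonempty V) → Subset (n * m)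
      inGraph   : ∀ V (ne : Nonempty V) → ⟦ A V ne ⟧ ⊆ GraphOn F V
      disparate : ∀ V (ne : Nonempty V) → IsDisparateSet G ⟦ A V ne ⟧
      large     : ∀ V (ne : Nonempty V) → ∣ A V ne ∣ ≥ ∣ V ∣

  HasDisparateSelection : SimpleGraph n → SetValued n m → Set
  HasDisparateSelection G F = ∃[ s ] (IsSelection F s × IsDisparateMap G s)

{-# OPTIONS --safe #-}
module Submission where

-- Adjacency-or-equality in a transitive graph is an equivalence relation, so
-- the graph is a disjoint union of complete graphs.  Let rep x be a canonical
-- vertex of the class of x.  A selection s is disparate exactly when the map
-- x ↦ (rep x , s x) is injective: two vertices may share a value unless they
-- lie in the same class.  Thus a disparate selection of F is a system of
-- distinct representatives of the family
--   tagged x = { (rep x , y) | y ∈ F x },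
-- and Hall's marriage theorem applies.  Its condition for tagged follows from
-- a Hall collection: on the disparate set A V, of cardinality at least that of
-- V, the map (x , y) ↦ (rep x , y) is injective, and it sends A V into the
-- image of V under tagged.  Conversely, if s is a disparate selection, its
-- graphs over the sets V form a Hall collection.
--
-- Hall's theorem is proved by Rado's argument.  If a family satisfying Hall's
-- condition has p ⊆ q ∪ r as its value at x, then p may be replaced by q or by
-- r without losing the condition (Hall-split); otherwise there
-- are a set violating the condition for q and one violating it for r, and
-- counting their union and intersection against the images gives a
-- contradiction (no-two-violators).  Splitting off one point at a time shrinks
-- the value at x to a singleton (Hall-refine).
-- Once every value is a singleton, Hall's condition on two-element sets says
-- that the resulting selection is injective.

open import Defs
open import Data.Nat using (ℕ)
open import Function.Bundles using (_⇔_)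

open import Data.Bool using (true; false)
open import Data.Fin using (Fin; zero; suc; combine; remQuot)
open import Data.Fin.Properties
  using (_≟_; any?; suc-injective; combine-injective; remQuot-combine; combine-surjective)
open import Data.Fin.Subset
  using (Subset; Nonempty; _∈_; _∉_; _⊆_; ∣_∣; ⁅_⁆; _∪_; _∩_; _-_; inside; outside)
open import Data.Fin.Subset.Properties
open import Data.List using (List; []; _∷_; allFin)
open import Data.List.Membership.Propositional using () renaming (_∈_ to _∈ᴸ_)
open import Data.List.Membership.Propositional.Properties using (∈-allFin)
open import Data.List.Relation.Unary.Any using (here; there)
open import Data.Nat using (suc; _+_; _*_; _≤_; _<_; z≤n; s≤s)
open import Data.Nat.Induction using (Acc; acc; <-wellFounded)
open import Data.Nat.Properties
  using (+-suc; +-mono-≤; m≤m+n; ≤-trans; ≤-reflexive;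
         <-irrefl; ≮⇒≥; _<?_; module ≤-Reasoning)
open import Data.Product using (_×_; _,_; proj₁; proj₂; ∃-syntax)
open import Data.Sum using (_⊎_; inj₁; inj₂)
open import Data.Vec using ([]; _∷_; here; there; tabulate)
open import Data.Vec.Functional using (updateAt)
open import Data.Vec.Functional.Properties using (updateAt-updates; updateAt-minimal)
open import Data.Vec.Properties using (lookup⇒[]=; []=⇒lookup; lookup∘tabulate)
open import Function using (_∘_; const; id; mk⇔)
open import Level using (0ℓ)
open import Relation.Binary.PropositionalEquality
open import Relation.Nullary using (¬_; Dec; yes; no; does; contradiction)
open import Relation.Nullary.Decidable using (dec-true; _×-dec_; _⊎-dec_)
open import Relation.Unary using (Pred; Decidable)

private
  variable
    n k : ℕ

-- Finite subsets and their cardinalities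

-- The subset { x | P x } cut out by a decidable predicate.
⟪_⟫ : {P : Pred (Fin n) 0ℓ} → Decidable P → Subset n
⟪ P? ⟫ = tabulate (does ∘ P?)

module _ {P : Pred (Fin n) 0ℓ} (P? : Decidable P) where

  ∈-⟪⟫⁺ : ∀ {x} → P x → x ∈ ⟪ P? ⟫
  ∈-⟪⟫⁺ {x} px = lookup⇒[]= x _ (trans (lookup∘tabulate (does ∘ P?) x) (dec-true (P? x) px))

  ∈-⟪⟫⁻ : ∀ {x} → x ∈ ⟪ P? ⟫ → P x
  ∈-⟪⟫⁻ {x} x∈ with P? x | trans (sym (lookup∘tabulate (does ∘ P?) x)) ([]=⇒lookup x∈)
  ... | yes px | _  = px
  ... | no  _  | ()

∣p∪q∣+∣p∩q∣≡∣p∣+∣q∣ : (p q : Subset n) → ∣ p ∪ q ∣ + ∣ p ∩ q ∣ ≡ ∣ p ∣ + ∣ q ∣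
∣p∪q∣+∣p∩q∣≡∣p∣+∣q∣ []          []          = refl
∣p∪q∣+∣p∩q∣≡∣p∣+∣q∣ (false ∷ p) (false ∷ q) = ∣p∪q∣+∣p∩q∣≡∣p∣+∣q∣ p q
∣p∪q∣+∣p∩q∣≡∣p∣+∣q∣ (false ∷ p) (true  ∷ q) =
  trans (cong suc (∣p∪q∣+∣p∩q∣≡∣p∣+∣q∣ p q)) (sym (+-suc _ _))
∣p∪q∣+∣p∩q∣≡∣p∣+∣q∣ (true  ∷ p) (false ∷ q) = cong suc (∣p∪q∣+∣p∩q∣≡∣p∣+∣q∣ p q)
∣p∪q∣+∣p∩q∣≡∣p∣+∣q∣ (true  ∷ p) (true  ∷ q) =
  cong suc (trans (+-suc _ _) (trans (cong suc (∣p∪q∣+∣p∩q∣≡∣p∣+∣q∣ p q)) (sym (+-suc _ _))))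

p⊆⁅x⁆∪p-x : (p : Subset n) (x : Fin n) → p ⊆ ⁅ x ⁆ ∪ (p - x)
p⊆⁅x⁆∪p-x p x {z} z∈p with z ≟ x
... | yes refl = x∈p∪q⁺ (inj₁ (x∈⁅x⁆ x))
... | no  z≢x  = x∈p∪q⁺ (inj₂ (x∈p∧x≢y⇒x∈p-y z∈p z≢x))

x∉p-x : (p : Subset n) (x : Fin n) → x ∉ p - x
x∉p-x (_ ∷ p) zero    ()
x∉p-x (_ ∷ p) (suc x) (there x∈) = x∉p-x p x x∈

∣p∣≤1+∣p-x∣ : (p : Subset n) (x : Fin n) → ∣ p ∣ ≤ suc ∣ p - x ∣
∣p∣≤1+∣p-x∣ p x = begin
  ∣ p ∣                                             ≤⟨ p⊆q⇒∣p∣≤∣q∣ (p⊆⁅x⁆∪p-x p x) ⟩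
  ∣ ⁅ x ⁆ ∪ (p - x) ∣                               ≤⟨ m≤m+n _ _ ⟩
  ∣ ⁅ x ⁆ ∪ (p - x) ∣ + ∣ ⁅ x ⁆ ∩ (p - x) ∣         ≡⟨ ∣p∪q∣+∣p∩q∣≡∣p∣+∣q∣ ⁅ x ⁆ (p - x) ⟩
  ∣ ⁅ x ⁆ ∣ + ∣ p - x ∣                             ≡⟨ cong (_+ ∣ p - x ∣) (∣⁅x⁆∣≡1 x) ⟩
  suc ∣ p - x ∣                                     ∎
  where open ≤-Reasoning

x∈p⇒0<∣p∣ : {x : Fin n} {p : Subset n} → x ∈ p → 0 < ∣ p ∣
x∈p⇒0<∣p∣ x∈p = ≤-trans (s≤s z≤n) (x∈p⇒∣p-x∣<∣p∣ x∈p)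

0<∣p∣⇒Nonempty : (p : Subset n) → 0 < ∣ p ∣ → Nonempty p
0<∣p∣⇒Nonempty {n} p 0<∣p∣ with nonempty? p
... | yes ne = ne
... | no ¬ne =
  contradiction 0<∣p∣ (<-irrefl (sym (trans (cong ∣_∣ (Empty-unique ¬ne)) (∣⊥∣≡0 n))))

injection⇒∣p∣≤∣q∣ : (p : Subset n) (q : Subset k) (f : Fin n → Fin k) →
  (∀ {x} → x ∈ p → f x ∈ q) →
  (∀ {x x′} → x ∈ p → x′ ∈ p → f x ≡ f x′ → x ≡ x′) →
  ∣ p ∣ ≤ ∣ q ∣
injection⇒∣p∣≤∣q∣ []            q f into inj = z≤n
injection⇒∣p∣≤∣q∣ (outside ∷ p) q f into inj =
  injection⇒∣p∣≤∣q∣ p q (f ∘ suc) (into ∘ there)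
    (λ x∈ x′∈ eq → suc-injective (inj (there x∈) (there x′∈) eq))
injection⇒∣p∣≤∣q∣ (inside  ∷ p) q f into inj =
  ≤-trans (s≤s ∣p∣≤∣q-f0∣) (x∈p⇒∣p-x∣<∣p∣ (into here))
  where
  0≢suc : ∀ {x} → x ∈ p → f (suc x) ≢ f zero
  0≢suc x∈ eq with () ← inj (there x∈) here eq

  ∣p∣≤∣q-f0∣ : ∣ p ∣ ≤ ∣ q - f zero ∣
  ∣p∣≤∣q-f0∣ = injection⇒∣p∣≤∣q∣ p (q - f zero) (f ∘ suc)
    (λ x∈ → x∈p∧x≢y⇒x∈p-y (into (there x∈)) (0≢suc x∈))
    (λ x∈ x′∈ eq → suc-injective (inj (there x∈) (there x′∈) eq))

-- Hall's marriage theorem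

in-image? : (F : SetValued n k) (V : Subset n) → Decidable (λ y → ∃[ x ] (x ∈ V × y ∈ F x))
in-image? F V y = any? (λ x → (x ∈? V) ×-dec (y ∈? F x))

-- The union of the sets F x over x ∈ V.
image : SetValued n k → Subset n → Subset k
image F V = ⟪ in-image? F V ⟫

module _ (F : SetValued n k) where

  ∈-image⁺ : ∀ {V x y} → x ∈ V → y ∈ F x → y ∈ image F V
  ∈-image⁺ {V} x∈V y∈Fx = ∈-⟪⟫⁺ (in-image? F V) (_ , x∈V , y∈Fx)

  ∈-image⁻ : ∀ {V y} → y ∈ image F V → ∃[ x ] (x ∈ V × y ∈ F x)
  ∈-image⁻ {V} = ∈-⟪⟫⁻ (in-image? F V)

image-⊆ : (F : SetValued n k) {V : Subset n} {q : Subset k} →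
  (∀ {x y} → x ∈ V → y ∈ F x → y ∈ q) → image F V ⊆ q
image-⊆ F F⊆q y∈ with _ , x∈V , y∈Fx ← ∈-image⁻ F y∈ = F⊆q x∈V y∈Fx

-- Hall's condition, for all subsets V; it holds trivially for the empty one.
Hall : SetValued n k → Set
Hall F = ∀ V → ∣ V ∣ ≤ ∣ image F V ∣

Hall⊎violator : (F : SetValued n k) → Hall F ⊎ ∃[ V ] ∣ image F V ∣ < ∣ V ∣
Hall⊎violator F with anySubset? (λ V → ∣ image F V ∣ <? ∣ V ∣)
... | yes violator = inj₂ violator
... | no ¬violator = inj₁ (λ V → ≮⇒≥ (λ lt → ¬violator (V , lt)))

Hall-mono : (F H : SetValued n k) → (∀ x → F x ⊆ H x) → Hall F → Hall H
Hall-mono F H F⊆H hall V =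
  ≤-trans (hall V) (p⊆q⇒∣p∣≤∣q∣ (image-⊆ F (λ {x} x∈V y∈ → ∈-image⁺ H x∈V (F⊆H x y∈))))

-- F with its value at x replaced by p.
_[_≔_] : SetValued n k → Fin n → Subset k → SetValued n k
F [ x ≔ p ] = updateAt F x (const p)

module _ (F : SetValued n k) (x : Fin n) where

  ∈-≔-same : ∀ {p y} → y ∈ (F [ x ≔ p ]) x → y ∈ p
  ∈-≔-same = subst (_ ∈_) (updateAt-updates x F)

  ∈-≔-here : ∀ {p y} → y ∈ p → y ∈ (F [ x ≔ p ]) x
  ∈-≔-here = subst (_ ∈_) (sym (updateAt-updates x F))

  ∈-≔-other : ∀ {p q z y} → z ≢ x → y ∈ (F [ x ≔ p ]) z → y ∈ (F [ x ≔ q ]) z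
  ∈-≔-other z≢x = subst (_ ∈_)
    (trans (updateAt-minimal _ x F z≢x) (sym (updateAt-minimal _ x F z≢x)))

  ⊆-≔-self : ∀ z → F z ⊆ (F [ x ≔ F x ]) z
  ⊆-≔-self z with z ≟ x
  ... | yes refl = ∈-≔-here
  ... | no  z≢x  = subst (_ ∈_) (sym (updateAt-minimal z x F z≢x))

  -- A set violating Hall's condition for F [ x ≔ q ] contains x, since off x
  -- nothing has changed.
  violator∋x : ∀ {p q} V → Hall (F [ x ≔ p ]) → ∣ image (F [ x ≔ q ]) V ∣ < ∣ V ∣ → x ∈ V
  violator∋x {p} {q} V hall lt with x ∈? V
  ... | yes x∈V = x∈V
  ... | no  x∉V = contradiction (≤-trans lt (≤-trans (hall V) (p⊆q⇒∣p∣≤∣q∣ unchanged))) (<-irrefl refl)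
    where
    unchanged : image (F [ x ≔ p ]) V ⊆ image (F [ x ≔ q ]) V
    unchanged = image-⊆ (F [ x ≔ p ]) λ z∈V y∈ →
      ∈-image⁺ (F [ x ≔ q ]) z∈V (∈-≔-other (λ { refl → x∉V z∈V }) y∈)

  -- The uncrossing step: sets V₁ and V₂ violating the condition for q and for
  -- r cannot both exist.  Both contain x, so the images I₁ and I₂ jointly cover
  -- the image of V₁ ∪ V₂, while I₁ ∩ I₂ covers that of (V₁ ∩ V₂) - x.
  no-two-violators : ∀ {p q r} → p ⊆ q ∪ r → Hall (F [ x ≔ p ]) → ∀ V₁ V₂ →
    ∣ image (F [ x ≔ q ]) V₁ ∣ < ∣ V₁ ∣ → ¬ ∣ image (F [ x ≔ r ]) V₂ ∣ < ∣ V₂ ∣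
  no-two-violators {p} {q} {r} p⊆q∪r hall V₁ V₂ lt₁ lt₂ = <-irrefl refl strict
    where
    I₁ I₂ : Subset k
    I₁ = image (F [ x ≔ q ]) V₁
    I₂ = image (F [ x ≔ r ]) V₂

    x∈V₁ : x ∈ V₁
    x∈V₁ = violator∋x V₁ hall lt₁

    x∈V₂ : x ∈ V₂
    x∈V₂ = violator∋x V₂ hall lt₂

    in-I₁ : ∀ {z y} → z ≢ x → z ∈ V₁ → y ∈ (F [ x ≔ p ]) z → y ∈ I₁
    in-I₁ z≢x z∈V₁ y∈ = ∈-image⁺ (F [ x ≔ q ]) z∈V₁ (∈-≔-other z≢x y∈)

    in-I₂ : ∀ {z y} → z ≢ x → z ∈ V₂ → y ∈ (F [ x ≔ p ]) z → y ∈ I₂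
    in-I₂ z≢x z∈V₂ y∈ = ∈-image⁺ (F [ x ≔ r ]) z∈V₂ (∈-≔-other z≢x y∈)

    union-case : ∀ {z y} → z ∈ V₁ ∪ V₂ → y ∈ (F [ x ≔ p ]) z → y ∈ I₁ ∪ I₂
    union-case {z} z∈ y∈ with z ≟ x
    union-case z∈ y∈ | yes refl with x∈p∪q⁻ q r (p⊆q∪r (∈-≔-same y∈))
    ... | inj₁ y∈q = x∈p∪q⁺ (inj₁ (∈-image⁺ (F [ x ≔ q ]) x∈V₁ (∈-≔-here y∈q)))
    ... | inj₂ y∈r = x∈p∪q⁺ (inj₂ (∈-image⁺ (F [ x ≔ r ]) x∈V₂ (∈-≔-here y∈r)))
    union-case z∈ y∈ | no z≢x with x∈p∪q⁻ V₁ V₂ z∈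
    ... | inj₁ z∈V₁ = x∈p∪q⁺ (inj₁ (in-I₁ z≢x z∈V₁ y∈))
    ... | inj₂ z∈V₂ = x∈p∪q⁺ (inj₂ (in-I₂ z≢x z∈V₂ y∈))

    W : Subset n
    W = (V₁ ∩ V₂) - x

    inter-case : ∀ {z y} → z ∈ W → y ∈ (F [ x ≔ p ]) z → y ∈ I₁ ∩ I₂
    inter-case {z} z∈W y∈ with z ≟ x | x∈p∩q⁻ V₁ V₂ (p─q⊆p (V₁ ∩ V₂) ⁅ x ⁆ z∈W)
    ... | yes refl | _            = contradiction z∈W (x∉p-x (V₁ ∩ V₂) x)
    ... | no  z≢x  | z∈V₁ , z∈V₂ = x∈p∩q⁺ (in-I₁ z≢x z∈V₁ y∈ , in-I₂ z≢x z∈V₂ y∈)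

    union-bound : ∣ V₁ ∪ V₂ ∣ ≤ ∣ I₁ ∪ I₂ ∣
    union-bound = ≤-trans (hall (V₁ ∪ V₂)) (p⊆q⇒∣p∣≤∣q∣ (image-⊆ (F [ x ≔ p ]) union-case))

    inter-bound : ∣ V₁ ∩ V₂ ∣ ≤ suc ∣ I₁ ∩ I₂ ∣
    inter-bound = ≤-trans (∣p∣≤1+∣p-x∣ (V₁ ∩ V₂) x)
      (s≤s (≤-trans (hall W) (p⊆q⇒∣p∣≤∣q∣ (image-⊆ (F [ x ≔ p ]) inter-case))))

    strict : ∣ V₁ ∣ + ∣ V₂ ∣ < ∣ V₁ ∣ + ∣ V₂ ∣
    strict = begin-strict
      ∣ V₁ ∣ + ∣ V₂ ∣                ≡⟨ ∣p∪q∣+∣p∩q∣≡∣p∣+∣q∣ V₁ V₂ ⟨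
      ∣ V₁ ∪ V₂ ∣ + ∣ V₁ ∩ V₂ ∣      ≤⟨ +-mono-≤ union-bound inter-bound ⟩
      ∣ I₁ ∪ I₂ ∣ + suc ∣ I₁ ∩ I₂ ∣  ≡⟨ +-suc _ _ ⟩
      suc (∣ I₁ ∪ I₂ ∣ + ∣ I₁ ∩ I₂ ∣) ≡⟨ cong suc (∣p∪q∣+∣p∩q∣≡∣p∣+∣q∣ I₁ I₂) ⟩
      suc (∣ I₁ ∣ + ∣ I₂ ∣)          ≡⟨ +-suc _ _ ⟨
      ∣ I₁ ∣ + suc ∣ I₂ ∣            <⟨ +-mono-≤ lt₁ lt₂ ⟩
      ∣ V₁ ∣ + ∣ V₂ ∣                ∎
      where open ≤-Reasoning

  Hall-split : ∀ {p q r} → p ⊆ q ∪ r → Hall (F [ x ≔ p ]) →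
    Hall (F [ x ≔ q ]) ⊎ Hall (F [ x ≔ r ])
  Hall-split {p} {q} {r} p⊆q∪r hall
    with Hall⊎violator (F [ x ≔ q ]) | Hall⊎violator (F [ x ≔ r ])
  ... | inj₁ hall-q     | _               = inj₁ hall-q
  ... | inj₂ _          | inj₁ hall-r     = inj₂ hall-r
  ... | inj₂ (V₁ , lt₁) | inj₂ (V₂ , lt₂) =
    contradiction lt₂ (no-two-violators p⊆q∪r hall V₁ V₂ lt₁)

  Hall⇒Nonempty : ∀ {p} → Hall (F [ x ≔ p ]) → Nonempty p
  Hall⇒Nonempty {p} hall = from-image (0<∣p∣⇒Nonempty (image (F [ x ≔ p ]) ⁅ x ⁆)
    (≤-trans (≤-reflexive (sym (∣⁅x⁆∣≡1 x))) (hall ⁅ x ⁆)))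
    where
    from-image : Nonempty (image (F [ x ≔ p ]) ⁅ x ⁆) → Nonempty p
    from-image (y , y∈) with z , z∈ , y∈Fz ← ∈-image⁻ (F [ x ≔ p ]) y∈
      with refl ← x∈⁅y⁆⇒x≡y x z∈ = y , ∈-≔-same y∈Fz

  Hall-refine : ∀ p → Acc _<_ ∣ p ∣ → Hall (F [ x ≔ p ]) →
    ∃[ y ] (y ∈ p × Hall (F [ x ≔ ⁅ y ⁆ ]))
  Hall-refine p (acc smaller) hall with y , y∈p ← Hall⇒Nonempty hall
    with Hall-split (p⊆⁅x⁆∪p-x p y) hall
  ... | inj₁ hall-y = y , y∈p , hall-y
  ... | inj₂ hall-rest
    with y′ , y′∈ , hall-y′ ← Hall-refine (p - y) (smaller (x∈p⇒∣p-x∣<∣p∣ y∈p)) hall-rest =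
      y′ , p─q⊆p p ⁅ y ⁆ y′∈ , hall-y′

Hall-refine-at : (F : SetValued n k) → Hall F → ∀ x →
  ∃[ y ] (y ∈ F x × Hall (F [ x ≔ ⁅ y ⁆ ]))
Hall-refine-at F hall x = Hall-refine F x (F x) (<-wellFounded ∣ F x ∣)
  (Hall-mono F (F [ x ≔ F x ]) (⊆-≔-self F x) hall)

-- H has smaller values than F, satisfies Hall's condition and is
-- single-valued on the list xs.
Refinement : SetValued n k → List (Fin n) → SetValued n k → Set
Refinement F xs H = Hall H × (∀ x → H x ⊆ F x) × (∀ {x} → x ∈ᴸ xs → ∃[ y ] H x ≡ ⁅ y ⁆)

extend-refinement : {F H : SetValued n k} {xs : List (Fin n)} (x : Fin n) (y : Fin k) →
  Refinement F xs H → y ∈ H x → Hall (H [ x ≔ ⁅ y ⁆ ]) →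
  Refinement F (x ∷ xs) (H [ x ≔ ⁅ y ⁆ ])
extend-refinement {F = F} {H} {xs} x y (_ , H⊆F , single) y∈Hx hall = hall , below , single′
  where
  below : ∀ z → (H [ x ≔ ⁅ y ⁆ ]) z ⊆ F z
  below z {w} w∈ with z ≟ x
  ... | no  z≢x  = H⊆F z (subst (w ∈_) (updateAt-minimal z x H z≢x) w∈)
  ... | yes refl = H⊆F x (subst (_∈ H x) (sym (x∈⁅y⁆⇒x≡y y (∈-≔-same H x w∈))) y∈Hx)

  -- An earlier singleton survives, unless it is replaced by another one.
  single′ : ∀ {z} → z ∈ᴸ (x ∷ xs) → ∃[ y′ ] (H [ x ≔ ⁅ y ⁆ ]) z ≡ ⁅ y′ ⁆
  single′ {z} z∈ with z ≟ x | z∈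
  ... | yes refl | _          = y , updateAt-updates x H
  ... | no  z≢x  | here z≡x   = contradiction z≡x z≢x
  ... | no  z≢x  | there z∈xs =
    proj₁ (single z∈xs) , trans (updateAt-minimal z x H z≢x) (proj₂ (single z∈xs))

Hall⇒refinement : (F : SetValued n k) → Hall F → ∀ xs → ∃[ H ] Refinement F xs H
Hall⇒refinement F hall []       = F , hall , (λ _ → id) , λ ()
Hall⇒refinement F hall (x ∷ xs) =
  let H , refinement     = Hall⇒refinement F hall xs
      y , y∈Hx , hall-Hy = Hall-refine-at H (proj₁ refinement) x
  in  H [ x ≔ ⁅ y ⁆ ] , extend-refinement x y refinement y∈Hx hall-Hy

Hall-singletons⇒injective : (g : Fin n → Fin k) → Hall (⁅_⁆ ∘ g) →
  ∀ {x x′} → g x ≡ g x′ → x ≡ x′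
Hall-singletons⇒injective g hall {x} {x′} gx≡gx′ with x ≟ x′
... | yes x≡x′ = x≡x′
... | no  x≢x′ = contradiction 1<1 (<-irrefl refl)
  where
  V : Subset _
  V = ⁅ x ⁆ ∪ ⁅ x′ ⁆

  image⊆⁅gx⁆ : image (⁅_⁆ ∘ g) V ⊆ ⁅ g x ⁆
  image⊆⁅gx⁆ = image-⊆ (⁅_⁆ ∘ g) go
    where
    go : ∀ {z y} → z ∈ V → y ∈ ⁅ g z ⁆ → y ∈ ⁅ g x ⁆
    go z∈V y∈ with x∈p∪q⁻ ⁅ x ⁆ ⁅ x′ ⁆ z∈V
    ... | inj₁ z∈ with refl ← x∈⁅y⁆⇒x≡y x z∈  = y∈
    ... | inj₂ z∈ with refl ← x∈⁅y⁆⇒x≡y x′ z∈ = subst (λ w → _ ∈ ⁅ w ⁆) (sym gx≡gx′) y∈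

  x′∈V : x′ ∈ V
  x′∈V = x∈p∪q⁺ (inj₂ (x∈⁅x⁆ x′))

  x∈V-x′ : x ∈ V - x′
  x∈V-x′ = x∈p∧x≢y⇒x∈p-y (x∈p∪q⁺ (inj₁ (x∈⁅x⁆ x))) x≢x′

  1<1 : 1 < 1
  1<1 = begin-strict
    1                           ≤⟨ x∈p⇒0<∣p∣ x∈V-x′ ⟩
    ∣ V - x′ ∣                  <⟨ x∈p⇒∣p-x∣<∣p∣ x′∈V ⟩
    ∣ V ∣                       ≤⟨ hall V ⟩
    ∣ image (⁅_⁆ ∘ g) V ∣       ≤⟨ p⊆q⇒∣p∣≤∣q∣ image⊆⁅gx⁆ ⟩
    ∣ ⁅ g x ⁆ ∣                 ≡⟨ ∣⁅x⁆∣≡1 (g x) ⟩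
    1                           ∎
    where open ≤-Reasoning

marriage : (F : SetValued n k) → Hall F →
  ∃[ g ] (IsSelection F g × (∀ {x x′} → g x ≡ g x′ → x ≡ x′))
marriage {n} F hall with H , hall-H , H⊆F , single ← Hall⇒refinement F hall (allFin n) =
  g , (λ x → H⊆F x (subst (g x ∈_) (sym (H≡⁅g⁆ x)) (x∈⁅x⁆ (g x)))) ,
  Hall-singletons⇒injective g (Hall-mono H (⁅_⁆ ∘ g) (λ x → subst (_ ∈_) (H≡⁅g⁆ x)) hall-H)
  where
  g = λ x → proj₁ (single (∈-allFin x))

  H≡⁅g⁆ : ∀ x → H x ≡ ⁅ g x ⁆
  H≡⁅g⁆ x = proj₂ (single (∈-allFin x))

-- Classes of a transitive graph

-- An element of a nonempty subset that depends on the subset alone.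
choose : (p : Subset n) → .(Nonempty p) → Fin n
choose (inside  ∷ p) ne = zero
choose (outside ∷ p) ne = suc (choose p (drop ne))
  where
  drop : Nonempty (outside ∷ p) → Nonempty p
  drop (suc x , there x∈p) = x , x∈p

choose-∈ : (p : Subset n) (ne : Nonempty p) → choose p ne ∈ p
choose-∈ (inside  ∷ p) ne                      = here
choose-∈ (outside ∷ p) (suc x , there x∈p) = there (choose-∈ p (x , x∈p))

choose-cong : {p q : Subset n} .(ne : Nonempty p) .(ne′ : Nonempty q) →
  p ≡ q → choose p ne ≡ choose q ne′
choose-cong _ _ refl = refl

module _ (G : SimpleGraph n) (transitive : IsTransitive G) where

  near? : ∀ x z → Dec (x ≡ z ⊎ Adj G x z)
  near? x z = (x ≟ z) ⊎-dec adj? G x z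

  -- The closed neighbourhood of x, which is the equivalence class of x.
  class : Fin n → Subset n
  class x = ⟪ near? x ⟫

  class-nonempty : ∀ x → Nonempty (class x)
  class-nonempty x = x , ∈-⟪⟫⁺ (near? x) (inj₁ refl)

  class-⊆ : ∀ {x x′} → Adj G x x′ → class x ⊆ class x′
  class-⊆ {x} {x′} x~x′ {z} z∈ with x′ ≟ z | ∈-⟪⟫⁻ (near? x) z∈
  ... | yes x′≡z | _         = ∈-⟪⟫⁺ (near? x′) (inj₁ x′≡z)
  ... | no  _    | inj₁ refl = ∈-⟪⟫⁺ (near? x′) (inj₂ (symm G x~x′))
  ... | no  x′≢z | inj₂ x~z  = ∈-⟪⟫⁺ (near? x′) (inj₂ (transitive (symm G x~x′) x~z x′≢z))

  -- The canonical vertex of the class of x.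
  rep : Fin n → Fin n
  rep x = choose (class x) (class-nonempty x)

  Adj⇒rep≡ : ∀ {x x′} → Adj G x x′ → rep x ≡ rep x′
  Adj⇒rep≡ {x} {x′} x~x′ = choose-cong (class-nonempty x) (class-nonempty x′)
    (⊆-antisym (class-⊆ x~x′) (class-⊆ (symm G x~x′)))

  rep-near : ∀ x → x ≡ rep x ⊎ Adj G x (rep x)
  rep-near x = ∈-⟪⟫⁻ (near? x) (choose-∈ (class x) (class-nonempty x))

  rep≡⇒Adj : ∀ {x x′} → rep x ≡ rep x′ → x ≢ x′ → Adj G x x′
  rep≡⇒Adj {x} {x′} eq x≢x′
    with rep-near x | subst (λ r → x′ ≡ r ⊎ Adj G x′ r) (sym eq) (rep-near x′)
  ... | inj₁ x≡r | inj₁ x′≡r = contradiction (trans x≡r (sym x′≡r)) x≢x′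
  ... | inj₁ x≡r | inj₂ x′~r = symm G (subst (Adj G x′) (sym x≡r) x′~r)
  ... | inj₂ x~r | inj₁ x′≡r = subst (Adj G x) (sym x′≡r) x~r
  ... | inj₂ x~r | inj₂ x′~r = transitive x~r (symm G x′~r) x≢x′

  -- Hall collections and disparate selections

  module _ {m : ℕ} (F : SetValued n m) where

    tagged? : ∀ x c → Dec (∃[ y ] (y ∈ F x × c ≡ combine (rep x) y))
    tagged? x c = any? (λ y → (y ∈? F x) ×-dec (c ≟ combine (rep x) y))

    -- The values of F at x, each paired with the class of x; the pairs are
    -- coded by combine.
    tagged : SetValued n (n * m)
    tagged x = ⟪ tagged? x ⟫

    -- The map (x , y) ↦ (rep x , y) on codes.
    tag : Fin (n * m) → Fin (n * m)
    tag c = combine (rep (proj₁ (remQuot {n} m c))) (proj₂ (remQuot {n} m c))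

    tag-combine : ∀ x y → tag (combine x y) ≡ combine (rep x) y
    tag-combine x y =
      cong (λ p → combine (rep (proj₁ p)) (proj₂ p)) (remQuot-combine {n} {m} x y)

    tag-injective-on-disparate : ∀ (A : Subset (n * m)) → IsDisparateSet G ⟦ A ⟧ →
      ∀ {c c′} → c ∈ A → c′ ∈ A → tag c ≡ tag c′ → c ≡ c′
    tag-injective-on-disparate A disp {c} {c′} c∈A c′∈A eq
      with x , y , refl ← combine-surjective {n} {m} c
         | x′ , y′ , refl ← combine-surjective {n} {m} c′
      with rx≡rx′ , refl ← combine-injective (rep x) y (rep x′) y′
             (trans (sym (tag-combine x y)) (trans eq (tag-combine x′ y′)))
      with x ≟ x′
    ... | yes refl = refl
    ... | no  x≢x′ = contradiction (rep≡⇒Adj rx≡rx′ x≢x′)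
      (proj₂ (disp c∈A c′∈A (x≢x′ ∘ cong proj₁)) refl)

    tag-∈-image : ∀ (A : Subset (n * m)) (V : Subset n) →
      (∀ {p} → ⟦ A ⟧ p → GraphOn F V p) → ∀ {c} → c ∈ A → tag c ∈ image tagged V
    tag-∈-image A V A⊆graph {c} c∈A with x , y , refl ← combine-surjective {n} {m} c
      with x∈V , y∈Fx ← A⊆graph c∈A =
      ∈-image⁺ tagged x∈V (∈-⟪⟫⁺ (tagged? x) (y , y∈Fx , tag-combine x y))

    HallCollection⇒Hall : HallCollection G F → Hall tagged
    HallCollection⇒Hall hc V with nonempty? V
    ... | no ¬ne with refl ← Empty-unique ¬ne = ≤-trans (≤-reflexive (∣⊥∣≡0 n)) z≤n
    ... | yes ne = ≤-trans (large V ne)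
      (injection⇒∣p∣≤∣q∣ (A V ne) (image tagged V) tag
        (tag-∈-image (A V ne) V (inGraph V ne))
        (tag-injective-on-disparate (A V ne) (disparate V ne)))
      where open HallCollection hc

    Hall⇒selection : Hall tagged → HasDisparateSelection G F
    Hall⇒selection hall with g , g∈tagged , g-inj ← marriage tagged hall = s , s∈F , s-disparate
      where
      decode : ∀ x → ∃[ y ] (y ∈ F x × g x ≡ combine (rep x) y)
      decode x = ∈-⟪⟫⁻ (tagged? x) (g∈tagged x)

      s : Fin n → Fin m
      s x = proj₁ (decode x)

      s∈F : IsSelection F s
      s∈F x = proj₁ (proj₂ (decode x))

      g≡ : ∀ x → g x ≡ combine (rep x) (s x)
      g≡ x = proj₂ (proj₂ (decode x))

      s-disparate : IsDisparateMap G s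
      s-disparate (x , refl) (x′ , refl) p≢q = p≢q , λ sx≡sx′ x~x′ →
        p≢q (cong (λ z → z , s z)
          (g-inj (trans (g≡ x) (trans (cong₂ combine (Adj⇒rep≡ x~x′) sx≡sx′) (sym (g≡ x′))))))

-- The Hall collection consists of the graphs of the restrictions of s.
selection⇒HallCollection : {m : ℕ} (G : SimpleGraph n) (F : SetValued n m) →
  HasDisparateSelection G F → HallCollection G F
selection⇒HallCollection {n} {m} G F (s , s∈F , s-disparate) = record
  { A         = λ V _ → graph V
  ; inGraph   = λ V _ → graph⊆ V
  ; disparate = λ V _ p∈ q∈ → s-disparate (on-graph V p∈) (on-graph V q∈)
  ; large     = λ V _ → injection⇒∣p∣≤∣q∣ V (graph V) (λ x → combine x (s x))
      (λ x∈V → ∈-⟪⟫⁺ (graph? V) (_ , x∈V , refl))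
      (λ {x} {x′} _ _ eq → proj₁ (combine-injective x (s x) x′ (s x′) eq))
  }
  where
  graph? : ∀ V c → Dec (∃[ x ] (x ∈ V × c ≡ combine x (s x)))
  graph? V c = any? (λ x → (x ∈? V) ×-dec (c ≟ combine x (s x)))

  -- The set of the points (x , s x) with x in V.
  graph : Subset n → Subset (n * m)
  graph V = ⟪ graph? V ⟫

  ∈-graph⁻ : ∀ V {x y} → combine x y ∈ graph V → x ∈ V × y ≡ s x
  ∈-graph⁻ V {x} {y} c∈ with x₀ , x₀∈V , eq ← ∈-⟪⟫⁻ (graph? V) c∈
    with refl , y≡ ← combine-injective x y x₀ (s x₀) eq = x₀∈V , y≡

  graph⊆ : ∀ V {p} → ⟦ graph V ⟧ p → GraphOn F V p
  graph⊆ V {x , y} c∈ with x∈V , refl ← ∈-graph⁻ V {x} {y} c∈ = x∈V , s∈F x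

  on-graph : ∀ V {p} → ⟦ graph V ⟧ p → ∃[ x ] p ≡ (x , s x)
  on-graph V {x , y} c∈ = x , cong (x ,_) (proj₂ (∈-graph⁻ V {x} {y} c∈))

theorem12p14 : ∀ (n m : ℕ) (G : SimpleGraph n) → IsTransitive G → (F : SetValued n m) →
    HallCollection G F ⇔ HasDisparateSelection G F
theorem12p14 n m G transitive F = mk⇔
  (Hall⇒selection G transitive F ∘ HallCollection⇒Hall G transitive F)
  (selection⇒HallCollection G F)
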